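{- For every positive integer $t$ and every finite graph $G$ of cliquewidth at most $t$, the hypergraph of balls in $G$ has a proper array sample compression scheme of size $4t+3$.
   Context: For a hypergraph $H$ (finite $V(H)$, $E(H)\subseteq 2^{V(H)}$): a sample is a pair $(X^+,X^-)$ of subsets of $V(H)$ such that some hyperedge $e$ has $X^+\subseteq e$, $X^-\cap e=\emptyset$; $\mathcal{S}(H)$ is the set of samples; $S$ realizes $(X^+,X^-)$ if $X^+\subseteq S$ and $S\cap X^-=\emptyset$. With a fresh symbol $\bot\notin V(H)$, an array sample compression scheme of size $k$ is a pair $(\kappa,\rho)$, $\kappa:\mathcal{S}(H)\to(V(H)\cup\{\bot\})^k$, $\rho:(V(H)\cup\{\bot\})^k\to 2^{V(H)}$, such that for every sample, $\kappa(X^+,X^-)\in(X^+\cup X^-\cup\{\bot\})^k$ and $\rho(\kappa(X^+,X^-))$ realizes $(X^+,X^-)$; it is proper if all values of $\rho$ are hyperedges. The hypergraph of balls in $G$ has vertex set $V(G)$ and hyperedges all $B_G(c,r)=\{v:\mathrm{dist}_G(c,v)\le r\}$, $c\in V(G)$, $r$ an integer. The cliquewidth of $G$ is the minimum $k$ such that $G$ can be built with labels in $[k]$ using: creation of a single labeled vertex; disjoint union; for labels $i\ne j$, adding all edges between label-$i$ and label-$j$ vertices; relabeling label $i$ to $j$. -}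

module Defs where

open import Data.Fin.Base using (Fin)
open import Data.Fin.Properties using (_≟_)
open import Data.Fin.Subset using (Subset; _∈_; _⊆_; _∩_; _∪_; Empty)
open import Data.Integer.Base as ℤ using (ℤ; +_)
open import Data.Maybe.Base using (Maybe)
import Data.Maybe.Relation.Unary.All as Maybe
open import Data.Nat.Base using (ℕ; zero; suc; _≤_)
open import Data.Product.Base using (Σ-syntax; ∃-syntax; _×_)
open import Data.Sum.Base using (_⊎_; [_,_]′)
open import Data.Sum.Relation.Binary.Pointwise using (Pointwise)
open import Data.Unit.Base using (⊤)
open import Data.Empty using (⊥)
open import Data.Vec.Base using (Vec)
open import Data.Vec.Relation.Unary.All using (All)
open import Function.Bundles using (_⇔_; _↔_; Inverse)
open import Level using (0ℓ)
open import Relation.Binary.Core using (Rel)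
open import Relation.Binary.Definitions using (Symmetric; Irreflexive; Decidable)
open import Relation.Binary.PropositionalEquality using (_≡_; _≢_)
open import Relation.Nullary.Decidable using (yes; no)
open import Relation.Unary using (Pred)

IsMinimum : ∀ {ℓ} → Pred ℕ ℓ → ℕ → Set ℓ
IsMinimum P m = P m × (∀ k → P k → m ≤ k)

record Graph (n : ℕ) : Set₁ where
  field
    Adj         : Rel (Fin n) 0ℓ
    symmetric   : Symmetric Adj
    irreflexive : Irreflexive _≡_ Adj
    adj?        : Decidable Adj

module _ {n : ℕ} (G : Graph n) where
  open Graph G

  data Walk : ℕ → Rel (Fin n) 0ℓ where
    []  : ∀ {u} → Walk zero u u
    _∷_ : ∀ {ℓ u v w} → Adj u v → Walk ℓ v w → Walk (suc ℓ) u w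

  -- No d satisfies this when u and v lie in different components: their
  -- distance is then infinite, so it is at most no integer.
  IsDist : Fin n → Fin n → ℕ → Set
  IsDist u v = IsMinimum (λ ℓ → Walk ℓ u v)

  DistAtMost : Fin n → Fin n → ℤ → Set
  DistAtMost u v r = ∃[ d ] IsDist u v d × + d ℤ.≤ r

  IsBall : Fin n → ℤ → Subset n → Set
  IsBall c r B = ∀ v → v ∈ B ⇔ DistAtMost c v r

-- A hypergraph on the vertex set Fin n is given by its set of hyperedges.
Hypergraph : ℕ → Set₁
Hypergraph n = Pred (Subset n) 0ℓ

ballHypergraph : ∀ {n} → Graph n → Hypergraph n
ballHypergraph G B = ∃[ c ] ∃[ r ] IsBall G c r B

IsSample : ∀ {n} → Hypergraph n → Subset n → Subset n → Set
IsSample H X⁺ X⁻ = ∃[ e ] H e × X⁺ ⊆ e × Empty (X⁻ ∩ e)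

Realizes : ∀ {n} → Subset n → Subset n → Subset n → Set
Realizes S X⁺ X⁻ = X⁺ ⊆ S × Empty (S ∩ X⁻)

-- The value nothing is the fresh symbol outside the vertex set.
Array : ℕ → ℕ → Set
Array n k = Vec (Maybe (Fin n)) k

record ArraySampleCompressionScheme {n : ℕ} (H : Hypergraph n) (k : ℕ) : Set where
  field
    -- The last argument is irrelevant so that κ is a function of the pair
    -- (X⁺ , X⁻) alone and cannot inspect the hyperedge witnessing the sample.
    κ        : (X⁺ X⁻ : Subset n) → .(IsSample H X⁺ X⁻) → Array n k
    ρ        : Array n k → Subset n
    κ-within : ∀ X⁺ X⁻ (s : IsSample H X⁺ X⁻) →
               All (Maybe.All (_∈ X⁺ ∪ X⁻)) (κ X⁺ X⁻ s)
    realizes : ∀ X⁺ X⁻ (s : IsSample H X⁺ X⁻) →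
               Realizes (ρ (κ X⁺ X⁻ s)) X⁺ X⁻

Proper : ∀ {n k} {H : Hypergraph n} → ArraySampleCompressionScheme H k → Set
Proper {H = H} scheme = ∀ a → H (ρ a)
  where open ArraySampleCompressionScheme scheme

HasProperArraySampleCompressionScheme : ∀ {n} → Hypergraph n → ℕ → Set
HasProperArraySampleCompressionScheme H k =
  Σ[ scheme ∈ ArraySampleCompressionScheme H k ] Proper scheme

data Expr (k : ℕ) : Set where
  vertex  : Fin k → Expr k
  _⊕_     : Expr k → Expr k → Expr k
  join    : (i j : Fin k) → i ≢ j → Expr k → Expr k
  relabel : (i j : Fin k) → Expr k → Expr k

-- The labelled graph built by an expression: vertices, labels and edges.
Vertex : ∀ {k} → Expr k → Set
Vertex (vertex _)      = ⊤
Vertex (a ⊕ b)         = Vertex a ⊎ Vertex b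
Vertex (join _ _ _ a)  = Vertex a
Vertex (relabel _ _ a) = Vertex a

rename : ∀ {k} → Fin k → Fin k → Fin k → Fin k
rename i j l with l ≟ i
... | yes _ = j
... | no  _ = l

label : ∀ {k} (e : Expr k) → Vertex e → Fin k
label (vertex i)      _ = i
label (a ⊕ b)           = [ label a , label b ]′
label (join _ _ _ a)    = label a
label (relabel i j a) u = rename i j (label a u)

Edge : ∀ {k} (e : Expr k) → Rel (Vertex e) 0ℓ
Edge (vertex _)      _ _ = ⊥
Edge (a ⊕ b)             = Pointwise (Edge a) (Edge b)
Edge (join i j _ a)  u v = Edge a u v
                         ⊎ (label a u ≡ i × label a v ≡ j)
                         ⊎ (label a u ≡ j × label a v ≡ i)
Edge (relabel _ _ a)     = Edge a

-- Expressions build graphs up to isomorphism.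
Builds : ∀ {n k} → Expr k → Graph n → Set
Builds {n} e G =
  Σ[ φ ∈ Fin n ↔ Vertex e ]
    (∀ u v → Graph.Adj G u v ⇔ Edge e (Inverse.to φ u) (Inverse.to φ v))

-- The graph without vertices is built by no expression, so it has no
-- cliquewidth.
IsCliquewidth : ∀ {n} → Graph n → ℕ → Set
IsCliquewidth G = IsMinimum (λ k → Σ[ e ∈ Expr k ] Builds e G)

CliquewidthAtMost : ∀ {n} → Graph n → ℕ → Set
CliquewidthAtMost G t = ∃[ k ] IsCliquewidth G k × k ≤ t

{-# OPTIONS --safe #-}

-- Let e be an expression building G.  The vertices below a node of e form a
-- set S with at most t labels such that equally labelled vertices of S have the
-- same neighbours outside S.  Hence for u in S and w outside S, dist(u,w) ≤ r
-- holds iff for some label i and some a ≤ r, a vertex of S labelled i is within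
-- a of u and all vertices of S labelled i are within r - a of w.  For a fixed i
-- the sets of w (or of u) admitted in this way form a chain, so a positive and
-- a negative sample vertex pin down how a ball cuts the sample through i.
-- A centre c that is a sample vertex is stored itself.  Otherwise there are
-- nodes x ⊆ z of e with c ∈ z \ x and all sample vertices in x or outside z,
-- where x is the lowest common ancestor of two sample vertices p and q, and z is
-- the whole expression or the child, towards p, of the lowest common ancestor of
-- p and a third sample vertex.  This makes 3 + 2 · 2t vertices.
module Submission where

open import Defs
open import Data.Empty using (⊥; ⊥-elim)
open import Data.Fin.Base as Fin using (Fin; zero; suc; toℕ; inject≤)
open import Data.Fin.Patterns
open import Data.Fin.Properties
  using (_≟_; any?; all?; pigeonhole; toℕ<n; inject≤-injective; +↔⊎; *↔×)
open import Data.Fin.Subset using (Subset; _∈_; _∩_; _∪_) renaming (⊥ to ∅)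
open import Data.Fin.Subset.Properties
  using (_∈?_; _⊆?_; nonempty?; x∈p∪q⁺; x∈p∩q⁺; x∈p∩q⁻; ∉⊥)
open import Data.Integer.Base as ℤ using (+_; -[1+_])
open import Data.Maybe.Base as Maybe using (Maybe; just; nothing)
import Data.Maybe.Relation.Unary.All as MaybeAll
open MaybeAll using (nothing; just)
open import Data.Maybe.Relation.Unary.Any using (Any; just)
open import Data.Nat.Base using (ℕ; zero; suc; _+_; _*_; _∸_; _≤_; _<_; z≤n; s≤s; s≤s⁻¹)
open import Data.Nat.Induction using (<-rec)
open import Data.Nat.Properties
  using (≤-refl; ≤-trans; ≤-total; ≰⇒>; <⇒≤; ≮⇒≥; _≤?_; n≤1+n; m≤m+n; m∸n≤m;
         +-monoˡ-<; +-mono-≤; ∸-monoˡ-≤; m+[n∸m]≡n; m+n∸m≡n; m∸[m∸n]≡n;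
         anyUpTo?)
open import Data.Product.Base using (∃; ∃-syntax; _×_; _,_; proj₁; proj₂)
open import Data.Product.Function.NonDependent.Propositional using (_×-↔_)
open import Data.Sum.Base using (_⊎_; inj₁; inj₂; reduce)
open import Data.Sum.Function.Propositional using (_⊎-↔_)
open import Data.Sum.Relation.Binary.Pointwise using (inj₁; inj₂)
open import Data.Unit.Base using (⊤; tt)
open import Data.Vec.Base using ([]; _∷_; lookup; tabulate)
open import Data.Vec.Properties using (lookup∘tabulate; lookup⇒[]=; []=⇒lookup)
import Data.Vec.Relation.Unary.All as VecAll
import Data.Vec.Relation.Unary.All.Properties as VecAll
open import Function.Base using (_∘_; id; case_of_)
open import Function.Bundles using (_⇔_; _↔_; mk⇔; Equivalence; Injection; Inverse)
open import Function.Construct.Composition using (_↔-∘_; _⇔-∘_)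
open import Function.Construct.Identity using (↔-id)
open import Function.Construct.Symmetry using (⇔-sym)
open import Function.Properties.Inverse using (↔⇒↣)
open import Level using (0ℓ)
open import Relation.Binary.Core using (Rel)
import Relation.Binary.Definitions as Binary
open import Relation.Binary.PropositionalEquality
  using (_≡_; _≢_; refl; sym; trans; cong; subst)
open import Relation.Nullary.Decidable
  using (Dec; yes; no; does; map′; _×-dec_; _→-dec_; ¬?; decidable-stable; recompute; dec-true)
open import Relation.Nullary.Negation using (¬_; contradiction)
open import Relation.Unary using (Pred; Decidable)

-- Finite search

comprehension : ∀ {n} {P : Pred (Fin n) 0ℓ} → Decidable P → Subset n
comprehension P? = tabulate (does ∘ P?)

∈-comprehension : ∀ {n} {P : Pred (Fin n) 0ℓ} (P? : Decidable P) {v} →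
                  v ∈ comprehension P? ⇔ P v
∈-comprehension {P = P} P? {v} = mk⇔ to from
  where
  to : v ∈ comprehension P? → P v
  to v∈ with P? v | trans (sym (lookup∘tabulate (does ∘ P?) v)) ([]=⇒lookup v∈)
  ... | yes p | _ = p
  from : P v → v ∈ comprehension P?
  from p = lookup⇒[]= v _ (trans (lookup∘tabulate (does ∘ P?) v) (dec-true (P? v) p))

anyMaybe? : ∀ {n} {P : Pred (Maybe (Fin n)) 0ℓ} → Decidable P → Dec (∃ P)
anyMaybe? {P = P} P? with P? nothing | any? (P? ∘ just)
... | yes p | _           = yes (nothing , p)
... | no _  | yes (v , p) = yes (just v , p)
... | no ¬p | no ¬q       = no λ { (nothing , p) → ¬p p ; (just v , q) → ¬q (v , q) }

-- There are finitely many arrays; this search later recovers a compressing array from an irrelevant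
-- sample proof.
anyArray? : ∀ {n k} {P : Pred (Array n k) 0ℓ} → Decidable P → Dec (∃ P)
anyArray? {k = zero}  P? = map′ ([] ,_) (λ { ([] , p) → p }) (P? [])
anyArray? {k = suc k} P? =
  map′ (λ (x , xs , p) → x ∷ xs , p) (λ { (x ∷ xs , p) → x , xs , p })
       (anyMaybe? λ x → anyArray? λ xs → P? (x ∷ xs))

least : ∀ {P : Pred ℕ 0ℓ} → Decidable P → ∀ {m} → P m → ∃[ d ] IsMinimum P d × d ≤ m
least {P} P? {m} = <-rec (λ m → P m → ∃[ d ] IsMinimum P d × d ≤ m) step m
  where
  step : ∀ m → (∀ {l} → l < m → P l → ∃[ d ] IsMinimum P d × d ≤ l) →
         P m → ∃[ d ] IsMinimum P d × d ≤ m
  step m rec p with anyUpTo? P? m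
  ... | yes (l , l<m , q) =
    let d , min , d≤l = rec l<m q in d , min , ≤-trans d≤l (<⇒≤ l<m)
  ... | no ∄ = m , (p , λ l q → ≮⇒≥ λ l<m → ∄ (l , l<m , q)) , ≤-refl

-- Picks the end of a chain, comparing `zero` with the greatest of the remaining elements. As `Any`
-- fails on `nothing`, the result is `nothing` exactly when `P` is empty.
greatest : ∀ {n} {_≼_ : Rel (Fin n) 0ℓ} → Binary.Transitive _≼_ → Binary.Total _≼_ →
           {P : Pred (Fin n) 0ℓ} → Decidable P →
           ∃[ m ] MaybeAll.All P m × (∀ v → P v → Any (v ≼_) m)
greatest {zero} _ _ _ = nothing , nothing , λ ()
greatest {suc n} {_≼_} ≼-trans total {P} P? =
  extend (greatest ≼-trans (λ u v → total (suc u) (suc v)) (P? ∘ suc)) (P? zero)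
  where
  Greatest : Set
  Greatest = ∃[ m ] MaybeAll.All P m × (∀ v → P v → Any (v ≼_) m)

  -- Totality at equal arguments gives reflexivity.
  0≼0 : zero ≼ zero
  0≼0 = reduce (total zero zero)

  extend : (∃[ m ] MaybeAll.All (P ∘ suc) m × (∀ v → P (suc v) → Any (λ u → suc v ≼ suc u) m)) →
           Dec (P zero) → Greatest
  extend (nothing , _ , top) (no ¬p) = nothing , nothing , λ where
    zero    p → contradiction p ¬p
    (suc v) p → case top v p of λ ()
  extend (nothing , _ , top) (yes p) = just zero , just p , λ where
    zero    _ → just 0≼0
    (suc v) q → case top v q of λ ()
  extend (just m , just q , top) (no ¬p) = just (suc m) , just q , λ where
    zero    p → contradiction p ¬p
    (suc v) p → case top v p of λ { (just v≼m) → just v≼m }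
  extend (just m , just q , top) (yes p) with total zero (suc m)
  ... | inj₁ 0≼m = just (suc m) , just q , λ where
    zero    _ → just 0≼m
    (suc v) r → case top v r of λ { (just v≼m) → just v≼m }
  ... | inj₂ m≼0 = just zero , just p , λ where
    zero    _ → just 0≼0
    (suc v) r → case top v r of λ { (just v≼m) → just (≼-trans v≼m m≼0) }

-- Sets of vertices given by the nodes of an expression

record Block {V : Set} (_~_ : Rel V 0ℓ) (t : ℕ) : Set₁ where
  field
    In    : Pred V 0ℓ
    in?   : Decidable In
    lab   : V → Fin t
    twins : ∀ {u u′ w} → In u → In u′ → lab u ≡ lab u′ → ¬ In w → u ~ w → u′ ~ w

-- `lab` is the label held when the subexpression was completed. Later relabellings may merge such
-- classes but never split them; this is `refines`, and it is why joins further up, which see only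
-- current labels, preserve `twins`.
record Node {k : ℕ} (e : Expr k) : Set₁ where
  field
    block   : Block (Edge e) k
  open Block block public
  field
    refines : ∀ {u u′} → In u → In u′ → lab u ≡ lab u′ → label e u ≡ label e u′

module _ {k : ℕ} where
  open Node using (In)

  whole : (e : Expr k) → Node e
  whole e = record
    { block = record
      { In    = λ _ → ⊤
      ; in?   = λ _ → yes tt
      ; lab   = label e
      ; twins = λ _ _ _ w∉ → contradiction tt w∉
      }
    ; refines = λ _ _ → id
    }

  left : ∀ {a} (b : Expr k) → Node a → Node (a ⊕ b)
  left {a} b A = record
    { block = record { In = L ; in? = L? ; lab = l ; twins = λ {u} {u′} {w} → tw {u} {u′} {w} }
    ; refines = λ {u} {u′} → ref {u} {u′}
    }
    where
    open Node A hiding (In)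
    L : Pred (Vertex (a ⊕ b)) 0ℓ
    L (inj₁ u) = In A u
    L (inj₂ _) = ⊥
    L? : Decidable L
    L? (inj₁ u) = in? u
    L? (inj₂ _) = no λ ()
    l : Vertex (a ⊕ b) → Fin k
    l (inj₁ u) = lab u
    l (inj₂ v) = label b v
    tw : ∀ {u u′ w} → L u → L u′ → l u ≡ l u′ → ¬ L w → Edge (a ⊕ b) u w → Edge (a ⊕ b) u′ w
    -- All other cases are void: a disjoint union has no edge between its parts, and `L` is empty on
    -- `b`.
    tw {inj₁ _} {inj₁ _} {inj₁ _} u∈ u′∈ eq w∉ (inj₁ uw) = inj₁ (twins u∈ u′∈ eq w∉ uw)
    ref : ∀ {u u′} → L u → L u′ → l u ≡ l u′ → label (a ⊕ b) u ≡ label (a ⊕ b) u′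
    ref {inj₁ _} {inj₁ _} = refines

  right : ∀ (a : Expr k) {b} → Node b → Node (a ⊕ b)
  right a {b} B = record
    { block = record { In = R ; in? = R? ; lab = l ; twins = λ {u} {u′} {w} → tw {u} {u′} {w} }
    ; refines = λ {u} {u′} → ref {u} {u′}
    }
    where
    open Node B hiding (In)
    R : Pred (Vertex (a ⊕ b)) 0ℓ
    R (inj₁ _) = ⊥
    R (inj₂ u) = In B u
    R? : Decidable R
    R? (inj₁ _) = no λ ()
    R? (inj₂ u) = in? u
    l : Vertex (a ⊕ b) → Fin k
    l (inj₁ v) = label a v
    l (inj₂ u) = lab u
    tw : ∀ {u u′ w} → R u → R u′ → l u ≡ l u′ → ¬ R w → Edge (a ⊕ b) u w → Edge (a ⊕ b) u′ w
    tw {inj₂ _} {inj₂ _} {inj₂ _} u∈ u′∈ eq w∉ (inj₂ uw) = inj₂ (twins u∈ u′∈ eq w∉ uw)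
    ref : ∀ {u u′} → R u → R u′ → l u ≡ l u′ → label (a ⊕ b) u ≡ label (a ⊕ b) u′
    ref {inj₂ _} {inj₂ _} = refines

  joined : ∀ i j (i≢j : i ≢ j) {a : Expr k} → Node a → Node (join i j i≢j a)
  joined i j i≢j {a} A = record
    { block = record { In = In A ; in? = in? ; lab = lab ; twins = tw }
    ; refines = refines
    }
    where
    open Node A hiding (In)
    tw : ∀ {u u′ w} → In A u → In A u′ → lab u ≡ lab u′ → ¬ In A w →
         Edge (join i j i≢j a) u w → Edge (join i j i≢j a) u′ w
    tw u∈ u′∈ eq w∉ (inj₁ uw) = inj₁ (twins u∈ u′∈ eq w∉ uw)
    -- On the side of `u`, a new edge depends only on the label in `a`, which `refines` transfers to
    -- `u′`.
    tw u∈ u′∈ eq w∉ (inj₂ (inj₁ (lu , lw))) =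
      inj₂ (inj₁ (trans (sym (refines u∈ u′∈ eq)) lu , lw))
    tw u∈ u′∈ eq w∉ (inj₂ (inj₂ (lu , lw))) =
      inj₂ (inj₂ (trans (sym (refines u∈ u′∈ eq)) lu , lw))

  relabelled : ∀ i j {a : Expr k} → Node a → Node (relabel i j a)
  relabelled i j A = record
    { block = record { In = In A ; in? = in? ; lab = lab ; twins = twins }
    ; refines = λ u∈ u′∈ eq → cong (rename i j) (refines u∈ u′∈ eq)
    }
    where open Node A hiding (In)

  -- For `p = q` the recursion ends at a leaf, so a single sample vertex yields a one-vertex block.
  lca : (e : Expr k) → Vertex e → Vertex e → Node e
  lca (vertex i)        _        _        = whole (vertex i)
  lca (a ⊕ b)           (inj₁ p) (inj₁ q) = left b (lca a p q)
  lca (a ⊕ b)           (inj₁ _) (inj₂ _) = whole (a ⊕ b)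
  lca (a ⊕ b)           (inj₂ _) (inj₁ _) = whole (a ⊕ b)
  lca (a ⊕ b)           (inj₂ p) (inj₂ q) = right a (lca b p q)
  lca (join i j i≢j a)  p        q        = joined i j i≢j (lca a p q)
  lca (relabel i j a)   p        q        = relabelled i j (lca a p q)

  -- The child, towards p, of the lowest common ancestor of p and q; the value
  -- for p = q is junk.
  outer : (e : Expr k) → Vertex e → Maybe (Vertex e) → Node e
  outer (vertex i)       _        _               = whole (vertex i)
  outer (a ⊕ b)          _        nothing         = whole (a ⊕ b)
  outer (a ⊕ b)          (inj₁ p) (just (inj₁ q)) = left b (outer a p (just q))
  outer (a ⊕ b)          (inj₁ _) (just (inj₂ _)) = left b (whole a)
  outer (a ⊕ b)          (inj₂ _) (just (inj₁ _)) = right a (whole b)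
  outer (a ⊕ b)          (inj₂ p) (just (inj₂ q)) = right a (outer b p (just q))
  outer (join i j i≢j a) p        q               = joined i j i≢j (outer a p q)
  outer (relabel i j a)  p        q               = relabelled i j (outer a p q)

  outer-nothing : ∀ e p v → In (outer e p nothing) v
  outer-nothing (vertex _)      _ _ = tt
  outer-nothing (_ ⊕ _)         _ _ = tt
  outer-nothing (join _ _ _ a)  p v = outer-nothing a p v
  outer-nothing (relabel _ _ a) p v = outer-nothing a p v

  anyVertex? : ∀ (e : Expr k) {X : Pred (Vertex e) 0ℓ} → Decidable X → Dec (∃ X)
  anyVertex? (vertex _) X? = map′ (tt ,_) proj₂ (X? tt)
  anyVertex? (a ⊕ b)    X? with anyVertex? a (X? ∘ inj₁) | anyVertex? b (X? ∘ inj₂)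
  ... | yes (v , x) | _           = yes (inj₁ v , x)
  ... | no _        | yes (v , x) = yes (inj₂ v , x)
  ... | no ¬x       | no ¬y       = no λ { (inj₁ v , x) → ¬x (v , x) ; (inj₂ v , y) → ¬y (v , y) }
  anyVertex? (join _ _ _ a)  X? = anyVertex? a X?
  anyVertex? (relabel _ _ a) X? = anyVertex? a X?

  record Span (e : Expr k) (X : Pred (Vertex e) 0ℓ) : Set where
    field
      p q   : Vertex e
      p∈    : X p
      q∈    : X q
      cover : ∀ v → X v → In (lca e p q) v

  -- Descends while `X` meets one child only. At the first union with both children met, one vertex
  -- from each has that union as lowest common ancestor.
  span : ∀ e {X} → Decidable X → ∃ X → Span e X
  span (vertex _) _ (v , x) = record { p = v ; q = v ; p∈ = x ; q∈ = x ; cover = λ _ _ → tt }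
  span (a ⊕ b) X? (v , x) with anyVertex? a (X? ∘ inj₁) | anyVertex? b (X? ∘ inj₂)
  ... | yes (u , y) | yes (w , z) =
    record { p = inj₁ u ; q = inj₂ w ; p∈ = y ; q∈ = z ; cover = λ _ _ → tt }
  ... | yes ∃a | no ∄b = record
    { p = inj₁ p ; q = inj₁ q ; p∈ = p∈ ; q∈ = q∈
    ; cover = λ { (inj₁ u) → cover u ; (inj₂ u) y → ∄b (u , y) } }
    where open Span (span a (X? ∘ inj₁) ∃a)
  ... | no ∄a | yes ∃b = record
    { p = inj₂ p ; q = inj₂ q ; p∈ = p∈ ; q∈ = q∈
    ; cover = λ { (inj₁ u) y → ∄a (u , y) ; (inj₂ u) → cover u } }
    where open Span (span b (X? ∘ inj₂) ∃b)
  span (a ⊕ b) X? (inj₁ v , x) | no ∄a | no _ = contradiction (v , x) ∄a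
  span (a ⊕ b) X? (inj₂ v , x) | no _ | no ∄b = contradiction (v , x) ∄b
  span (join _ _ _ a)  X? ∃X = record { Span (span a X? ∃X) }
  span (relabel _ _ a) X? ∃X = record { Span (span a X? ∃X) }

  record Separation (e : Expr k) (X : Pred (Vertex e) 0ℓ) (c : Vertex e) : Set where
    field
      p q   : Vertex e
      m     : Maybe (Vertex e)
      p∈    : X p
      q∈    : X q
      m∈    : MaybeAll.All X m
      c∉    : ¬ In (lca e p q) c
      c∈    : In (outer e p m) c
      cover : ∀ v → X v → In (lca e p q) v ⊎ ¬ In (outer e p m) v

    coverAll : m ≡ nothing → ∀ v → X v → In (lca e p q) v
    coverAll m≡nothing v x with cover v x
    ... | inj₁ v∈ = v∈
    ... | inj₂ v∉ rewrite m≡nothing = contradiction (outer-nothing e p v) v∉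

  -- Descends towards `c` while the child containing `c` meets `X`. At the first union where it does
  -- not, all of `X` lies in the sibling, whose span gives `p` and `q`. On the way back up, `m`
  -- stays `nothing` until a sibling contains a vertex of `X`; that vertex becomes `m` for good.
  separate : ∀ e {X} → Decidable X → ∃ X → ∀ {c} → ¬ X c → Separation e X c
  separate (vertex _) _ (_ , x) ¬x = contradiction x ¬x
  separate (a ⊕ b) {X} X? (v , x) {inj₁ c} ¬x
    with anyVertex? a (X? ∘ inj₁) | anyVertex? b (X? ∘ inj₂)
  ... | yes ∃a | any-b = extend (separate a (X? ∘ inj₁) ∃a ¬x) any-b
    where
    extend : Separation a (X ∘ inj₁) c → Dec (∃ (X ∘ inj₂)) → Separation (a ⊕ b) X (inj₁ c)
    extend S@record { m = just m ; m∈ = just m∈ } _ = record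
      { p = inj₁ p ; q = inj₁ q ; m = just (inj₁ m) ; p∈ = p∈ ; q∈ = q∈ ; m∈ = just m∈
      ; c∉ = c∉ ; c∈ = c∈ ; cover = λ { (inj₁ u) → cover u ; (inj₂ u) _ → inj₂ id } }
      where open Separation S using (p; q; p∈; q∈; c∉; c∈; cover)
    -- All of `X` in `a` lies in the block of `lca`, so `outer` may now be all of `a`, which leaves
    -- every vertex of `b` outside.
    extend S@record { m = nothing } (yes (s , s∈)) = record
      { p = inj₁ p ; q = inj₁ q ; m = just (inj₂ s) ; p∈ = p∈ ; q∈ = q∈ ; m∈ = just s∈
      ; c∉ = c∉ ; c∈ = tt
      ; cover = λ { (inj₁ u) y → inj₁ (coverAll refl u y) ; (inj₂ u) _ → inj₂ id } }
      where open Separation S using (p; q; p∈; q∈; c∉; coverAll)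
    extend S@record { m = nothing } (no ∄s) = record
      { p = inj₁ p ; q = inj₁ q ; m = nothing ; p∈ = p∈ ; q∈ = q∈ ; m∈ = nothing
      ; c∉ = c∉ ; c∈ = tt
      ; cover = λ { (inj₁ u) y → inj₁ (coverAll refl u y)
                  ; (inj₂ u) y → contradiction (u , y) ∄s } }
      where open Separation S using (p; q; p∈; q∈; c∉; coverAll)
  ... | no ∄a | yes ∃b = record
    { p = inj₂ p ; q = inj₂ q ; m = nothing ; p∈ = p∈ ; q∈ = q∈ ; m∈ = nothing
    ; c∉ = id ; c∈ = tt
    ; cover = λ { (inj₁ u) y → contradiction (u , y) ∄a ; (inj₂ u) y → inj₁ (cover u y) } }
    where open Span (span b (X? ∘ inj₂) ∃b)
  separate (a ⊕ b) X? (inj₁ v , x) {inj₁ c} ¬x | no ∄a | no _ = contradiction (v , x) ∄a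
  separate (a ⊕ b) X? (inj₂ v , x) {inj₁ c} ¬x | no _ | no ∄b = contradiction (v , x) ∄b
  separate (a ⊕ b) {X} X? (v , x) {inj₂ c} ¬x
    with anyVertex? a (X? ∘ inj₁) | anyVertex? b (X? ∘ inj₂)
  ... | any-a | yes ∃b = extend (separate b (X? ∘ inj₂) ∃b ¬x) any-a
    where
    extend : Separation b (X ∘ inj₂) c → Dec (∃ (X ∘ inj₁)) → Separation (a ⊕ b) X (inj₂ c)
    extend S@record { m = just m ; m∈ = just m∈ } _ = record
      { p = inj₂ p ; q = inj₂ q ; m = just (inj₂ m) ; p∈ = p∈ ; q∈ = q∈ ; m∈ = just m∈
      ; c∉ = c∉ ; c∈ = c∈ ; cover = λ { (inj₁ u) _ → inj₂ id ; (inj₂ u) → cover u } }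
      where open Separation S using (p; q; p∈; q∈; c∉; c∈; cover)
    extend S@record { m = nothing } (yes (s , s∈)) = record
      { p = inj₂ p ; q = inj₂ q ; m = just (inj₁ s) ; p∈ = p∈ ; q∈ = q∈ ; m∈ = just s∈
      ; c∉ = c∉ ; c∈ = tt
      ; cover = λ { (inj₁ u) _ → inj₂ id ; (inj₂ u) y → inj₁ (coverAll refl u y) } }
      where open Separation S using (p; q; p∈; q∈; c∉; coverAll)
    extend S@record { m = nothing } (no ∄s) = record
      { p = inj₂ p ; q = inj₂ q ; m = nothing ; p∈ = p∈ ; q∈ = q∈ ; m∈ = nothing
      ; c∉ = c∉ ; c∈ = tt
      ; cover = λ { (inj₁ u) y → contradiction (u , y) ∄s
                  ; (inj₂ u) y → inj₁ (coverAll refl u y) } }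
      where open Separation S using (p; q; p∈; q∈; c∉; coverAll)
  ... | yes ∃a | no ∄b = record
    { p = inj₁ p ; q = inj₁ q ; m = nothing ; p∈ = p∈ ; q∈ = q∈ ; m∈ = nothing
    ; c∉ = id ; c∈ = tt
    ; cover = λ { (inj₁ u) y → inj₁ (cover u y) ; (inj₂ u) y → contradiction (u , y) ∄b } }
    where open Span (span a (X? ∘ inj₁) ∃a)
  separate (a ⊕ b) X? (inj₁ v , x) {inj₂ c} ¬x | no ∄a | no _ = contradiction (v , x) ∄a
  separate (a ⊕ b) X? (inj₂ v , x) {inj₂ c} ¬x | no _ | no ∄b = contradiction (v , x) ∄b
  -- Joins and relabellings keep the vertex set and `In`, so all fields carry over.
  separate (join _ _ _ a)  X? ∃X ¬x = record { Separation (separate a X? ∃X ¬x) }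
  separate (relabel _ _ a) X? ∃X ¬x = record { Separation (separate a X? ∃X ¬x) }

-- Walks and balls

module _ {n : ℕ} (G : Graph n) where
  open Graph G

  snoc : ∀ {ℓ u v w} → Walk G ℓ u v → Adj v w → Walk G (suc ℓ) u w
  snoc []       vw = vw ∷ []
  snoc (uv ∷ p) vw = uv ∷ snoc p vw

  reverse : ∀ {ℓ u v} → Walk G ℓ u v → Walk G ℓ v u
  reverse []       = []
  reverse (uv ∷ p) = snoc (reverse p) (symmetric uv)

  append : ∀ {ℓ m u v w} → Walk G ℓ u v → Walk G m v w → Walk G (ℓ + m) u w
  append []       q = q
  append (uv ∷ p) q = uv ∷ append p q

  walk? : ∀ ℓ u v → Dec (Walk G ℓ u v)
  walk? zero    u v = map′ (λ { refl → [] }) (λ { [] → refl }) (u ≟ v)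
  walk? (suc ℓ) u w = map′ (λ (v , uv , p) → uv ∷ p) (λ { (uv ∷ p) → _ , uv , p })
                           (any? λ v → adj? u v ×-dec walk? ℓ v w)

  visit : ∀ {ℓ u v} → Walk G ℓ u v → Fin (suc ℓ) → Fin n
  visit {u = u} _        zero    = u
  visit         (_ ∷ p) (suc i) = visit p i

  prefix : ∀ {ℓ u v} (p : Walk G ℓ u v) i → Walk G (toℕ i) u (visit p i)
  prefix _        zero    = []
  prefix (uv ∷ p) (suc i) = uv ∷ prefix p i

  suffix : ∀ {ℓ u v} (p : Walk G ℓ u v) i → Walk G (ℓ ∸ toℕ i) (visit p i) v
  suffix p       zero    = p
  suffix (_ ∷ p) (suc i) = suffix p i

  -- Distance at most `r`, without minimality; the bound has the shape that `anyUpTo?` searches.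
  Reach : ℕ → Rel (Fin n) 0ℓ
  Reach r u v = ∃[ ℓ ] ℓ < suc r × Walk G ℓ u v

  reach? : ∀ r u v → Dec (Reach r u v)
  reach? r u v = anyUpTo? (λ ℓ → walk? ℓ u v) (suc r)

  reach-mono : ∀ {r s u v} → r ≤ s → Reach r u v → Reach s u v
  reach-mono r≤s (ℓ , ℓ≤r , p) = ℓ , ≤-trans ℓ≤r (s≤s r≤s) , p

  reach-sym : ∀ {r u v} → Reach r u v → Reach r v u
  reach-sym (ℓ , ℓ≤r , p) = ℓ , ℓ≤r , reverse p

  reach-trans : ∀ {r a u v w} → a ≤ r → Reach a u v → Reach (r ∸ a) v w → Reach r u w
  reach-trans {r} {a} a≤r (ℓ , s≤s ℓ≤a , p) (m , s≤s m≤r∸a , q) =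
    ℓ + m , s≤s (subst (ℓ + m ≤_) (m+[n∸m]≡n a≤r) (+-mono-≤ ℓ≤a m≤r∸a)) , append p q

  -- A walk longer than `n` repeats a vertex, and the closed piece between two visits can be cut
  -- out. This caps radii at `n`.
  reach-bounded : ∀ {ℓ u v} → Walk G ℓ u v → Reach n u v
  reach-bounded {ℓ} = <-rec (λ ℓ → ∀ {u v} → Walk G ℓ u v → Reach n u v) step ℓ
    where
    step : ∀ ℓ → (∀ {m} → m < ℓ → ∀ {u v} → Walk G m u v → Reach n u v) →
           ∀ {u v} → Walk G ℓ u v → Reach n u v
    step ℓ rec {u} {v} p with ℓ ≤? n
    ... | yes ℓ≤n = ℓ , s≤s ℓ≤n , p
    ... | no  ℓ≰n with pigeonhole (≤-trans (≰⇒> ℓ≰n) (n≤1+n ℓ)) (visit p)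
    ...   | i , j , i<j , eq =
      rec shorter (append (prefix p i) (subst (λ w → Walk G _ w v) (sym eq) (suffix p j)))
      where
      shorter : toℕ i + (ℓ ∸ toℕ j) < ℓ
      shorter = subst (toℕ i + (ℓ ∸ toℕ j) <_) (m+[n∸m]≡n (s≤s⁻¹ (toℕ<n j)))
                      (+-monoˡ-< (ℓ ∸ toℕ j) i<j)

  ball : ℕ → Fin n → Subset n
  ball r c = comprehension (reach? r c)

  reach⇔distAtMost : ∀ {r c v} → Reach r c v ⇔ DistAtMost G c v (+ r)
  reach⇔distAtMost {r} {c} {v} = mk⇔ to from
    where
    to : Reach r c v → DistAtMost G c v (+ r)
    to (ℓ , s≤s ℓ≤r , p) =
      let d , min , d≤ℓ = least (λ ℓ → walk? ℓ c v) p
      in d , min , ℤ.+≤+ (≤-trans d≤ℓ ℓ≤r)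
    from : DistAtMost G c v (+ r) → Reach r c v
    from (d , (p , _) , ℤ.+≤+ d≤r) = d , s≤s d≤r , p

  ball-isBall : ∀ r c → IsBall G c (+ r) (ball r c)
  ball-isBall r c v = reach⇔distAtMost ⇔-∘ ∈-comprehension (reach? r c)

  -- No distance is at most -1. This makes the default value of `ballOf` a hyperedge.
  ∅-isBall : ∀ c → IsBall G c -[1+ 0 ] ∅
  ∅-isBall c v = mk⇔ (λ v∈ → contradiction v∈ ∉⊥) (λ { (_ , _ , ()) })

  -- A member `v` excludes negative radii, and `reach-bounded` lowers radii above `n`, so that
  -- decoding searches finitely many radii.
  isBall-bounded : ∀ {c r B v} → IsBall G c r B → v ∈ B →
                   ∃[ s ] s ≤ n × (∀ w → w ∈ B ⇔ Reach s c w)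
  isBall-bounded {r = -[1+ _ ]} {v = v} isBall v∈ with Equivalence.to (isBall v) v∈
  ... | _ , _ , ()
  isBall-bounded {c} {+ r} isBall _ with r ≤? n
  ... | yes r≤n = r , r≤n , λ w → ⇔-sym reach⇔distAtMost ⇔-∘ isBall w
  ... | no  r≰n = n , ≤-refl , λ w → mk⇔ reach-n reach-r ⇔-∘ (⇔-sym reach⇔distAtMost ⇔-∘ isBall w)
    where
    reach-n : ∀ {w} → Reach r c w → Reach n c w
    reach-n (_ , _ , p) = reach-bounded p
    reach-r : ∀ {w} → Reach n c w → Reach r c w
    reach-r = reach-mono (<⇒≤ (≰⇒> r≰n))

  -- A side splits the statement dist(c,v) ≤ r, for c in Center and v in Scope,
  -- as a disjunction over i of P i c a and Q i v (r - a) for some a ≤ r.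
  record Side (t : ℕ) : Set₁ where
    field
      Center Scope : Pred (Fin n) 0ℓ
      center?      : Decidable Center
      P Q          : Fin t → Fin n → ℕ → Set
      P?           : ∀ i c a → Dec (P i c a)
      Q?           : ∀ i v a → Dec (Q i v a)
      Q-mono       : ∀ {i v a b} → a ≤ b → Q i v a → Q i v b

    Through : Fin t → ℕ → Rel (Fin n) 0ℓ
    Through i r c v = ∃[ a ] a < suc r × P i c a × Q i v (r ∸ a)

    field
      split : ∀ {r c v} → Center c → Scope v → Reach r c v → ∃[ i ] Through i r c v
      glue  : ∀ {i r c v} → Center c → Scope v → Through i r c v → Reach r c v

    through? : ∀ i r c v → Dec (Through i r c v)
    through? i r c v = anyUpTo? (λ a → P? i c a ×-dec Q? i v (r ∸ a)) (suc r)

    -- The chain order of direction `i`. Thresholds stop at `n`, which suffices for radii up to `n`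
    -- and keeps the comparison a finite search.
    Before : Fin t → Rel (Fin n) 0ℓ
    Before i u v = ∀ a → a ≤ n → Q i v a → Q i u a

    before-trans : ∀ {i} → Binary.Transitive (Before i)
    before-trans u≼v v≼w a a≤n = u≼v a a≤n ∘ v≼w a a≤n

    -- By `Q-mono` each vertex has an upward closed set of thresholds, and two such sets are
    -- comparable by inclusion.
    before-total : ∀ {i} → Binary.Total (Before i)
    before-total {i} u v with anyUpTo? (λ a → Q? i v a ×-dec ¬? (Q? i u a)) (suc n)
    ... | no ∄a = inj₁ λ a a≤n q →
      decidable-stable (Q? i u a) λ ¬q → ∄a (a , s≤s a≤n , q , ¬q)
    ... | yes (a , _ , q , ¬q) = inj₂ λ b _ q′ → case ≤-total a b of λ where
      (inj₁ a≤b) → Q-mono a≤b q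
      (inj₂ b≤a) → contradiction (Q-mono b≤a q′) ¬q

    through-before : ∀ {i r c u v} → r ≤ n → Before i u v → Through i r c v → Through i r c u
    through-before {r = r} r≤n u≼v (a , a≤r , p , q) =
      a , a≤r , p , u≼v _ (≤-trans (m∸n≤m r a) r≤n) q

  -- For a centre stored as `p`. Distance from `p` is itself a chain, so one direction suffices;
  -- `0 < t` provides it.
  point : ∀ {t} → 0 < t → Fin n → Side t
  point 0<t p = record
    { Center = _≡ p ; Scope = λ _ → ⊤ ; center? = _≟ p
    ; P = λ _ _ _ → ⊤ ; Q = λ _ v a → Reach a p v
    ; P? = λ _ _ _ → yes tt ; Q? = λ _ v a → reach? a p v ; Q-mono = reach-mono
    ; split = λ { refl _ reach → Fin.fromℕ< 0<t , 0 , s≤s z≤n , tt , reach }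
    ; glue = λ { {r = r} refl _ (a , _ , _ , reach) → reach-mono (m∸n≤m r a) reach }
    }

  -- Admits no centre, so arrays with this side decode to the default.
  void : ∀ {t} → Side t
  void = record
    { Center = λ _ → ⊥ ; Scope = λ _ → ⊥ ; center? = λ _ → no λ ()
    ; P = λ _ _ _ → ⊥ ; Q = λ _ _ _ → ⊥
    ; P? = λ _ _ _ → no λ () ; Q? = λ _ _ _ → no λ () ; Q-mono = λ _ ()
    ; split = λ () ; glue = λ ()
    }

  -- Distances across the boundary of a block

  module _ {t : ℕ} (B : Block Adj t) where
    open Block B

    -- A walk leaving the block from a vertex labelled `i` can be rerouted to leave from any vertex
    -- with that label. Hence `All` may quantify universally, and it then combines with whichever
    -- vertex `Some` provides.
    Some All : Fin t → Fin n → ℕ → Set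
    Some i u a = ∃[ p ] In p × lab p ≡ i × Reach a u p
    All  i w a = ∀ p → In p → lab p ≡ i → Reach a p w

    some? : ∀ i u a → Dec (Some i u a)
    some? i u a = any? λ p → in? p ×-dec (lab p ≟ i) ×-dec reach? a u p

    all-reach? : ∀ i w a → Dec (All i w a)
    all-reach? i w a = all? λ p → in? p →-dec ((lab p ≟ i) →-dec reach? a p w)

    some-mono : ∀ {i u a b} → a ≤ b → Some i u a → Some i u b
    some-mono a≤b (p , p∈ , eq , reach) = p , p∈ , eq , reach-mono a≤b reach

    all-mono : ∀ {i w a b} → a ≤ b → All i w a → All i w b
    all-mono a≤b reach p p∈ eq = reach-mono a≤b (reach p p∈ eq)

    crossing : ∀ {ℓ u w} → In u → ¬ In w → Walk G ℓ u w →
               ∃[ a ] ∃[ p ] ∃[ q ] ∃[ b ] a + suc b ≡ ℓ × Walk G a u p × In p ×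
                 Adj p q × ¬ In q × Walk G b q w
    crossing u∈ w∉ [] = contradiction u∈ w∉
    crossing {u = u} u∈ w∉ (_∷_ {v = v} uv walk) with in? v
    ... | no  v∉ = 0 , u , v , _ , refl , [] , u∈ , uv , v∉ , walk
    ... | yes v∈ =
      let a , p , q , b , eq , walk₁ , rest = crossing v∈ w∉ walk
      in suc a , p , q , b , cong suc eq , uv ∷ walk₁ , rest

    -- Any edge pq of the walk leaving the block will do: all vertices of the
    -- block with the label of p are adjacent to q.
    split-at-block : ∀ {r u w} → In u → ¬ In w → Reach r u w →
                     ∃[ i ] ∃[ a ] a < suc r × Some i u a × All i w (r ∸ a)
    split-at-block {r} u∈ w∉ (ℓ , s≤s ℓ≤r , walk) with crossing u∈ w∉ walk
    ... | a , p , q , b , refl , walk₁ , p∈ , pq , q∉ , walk₂ =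
      lab p , a , s≤s (≤-trans (m≤m+n a _) ℓ≤r) ,
      (p , p∈ , refl , a , ≤-refl , walk₁) ,
      λ p′ p′∈ eq → suc b , s≤s b<r∸a , twins p∈ p′∈ (sym eq) q∉ pq ∷ walk₂
      where
      b<r∸a : suc b ≤ r ∸ a
      b<r∸a = subst (_≤ r ∸ a) (m+n∸m≡n a (suc b)) (∸-monoˡ-≤ a ℓ≤r)

    glue-at-block : ∀ {i r a u w} → a ≤ r → Some i u a → All i w (r ∸ a) → Reach r u w
    glue-at-block a≤r (p , p∈ , eq , reach) all = reach-trans a≤r reach (all p p∈ eq)

    outward : Side t
    outward = record
      { Center = In ; Scope = λ v → ¬ In v ; center? = in?
      ; P = Some ; Q = All ; P? = some? ; Q? = all-reach? ; Q-mono = all-mono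
      ; split = split-at-block
      ; glue = λ { _ _ (a , s≤s a≤r , some , all) → glue-at-block a≤r some all }
      }

    inward : Side t
    inward = record
      { Center = λ c → ¬ In c ; Scope = In ; center? = λ c → ¬? (in? c)
      ; P = All ; Q = Some ; P? = all-reach? ; Q? = some? ; Q-mono = some-mono
      -- The reversed walk starts in the block. The budgets `a` and `r ∸ a` swap roles, so
      -- `r ∸ (r ∸ a)` has to be rewritten to `a`.
      ; split = λ {r} {c} {v} c∉ v∈ reach →
          let i , a , a≤r , some , all = split-at-block v∈ c∉ (reach-sym reach)
          in i , r ∸ a , s≤s (m∸n≤m r a) , all ,
             subst (Some i v) (sym (m∸[m∸n]≡n (s≤s⁻¹ a≤r))) some
      ; glue = λ { {i} {r} {c} _ _ (a , s≤s a≤r , all , some) →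
          reach-sym (glue-at-block (m∸n≤m r a) some (subst (All i c) (sym (m∸[m∸n]≡n a≤r)) all)) }
      }

-- Arrays

Slot : ℕ → Set
Slot t = ((Fin 2 × Fin 2) × Fin t) ⊎ Fin 3

-- (side , sign) , direction for a farthest positive (sign 0) or a nearest
-- negative (sign 1) sample vertex; the last three slots encode the sides.
slot↔ : ∀ t → Fin (4 * t + 3) ↔ Slot t
slot↔ t = (((*↔× {2} {2} ×-↔ ↔-id _) ↔-∘ *↔× {4} {t}) ⊎-↔ ↔-id _) ↔-∘ +↔⊎ {4 * t} {3}

module Scheme {n k t : ℕ} (G : Graph n) (0<t : 0 < t) (k≤t : k ≤ t)
              (e : Expr k) (builds : Builds e G) where
  open Graph G
  private module φ = Inverse (proj₁ builds)
  private module slot = Inverse (slot↔ t)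

  edge⇔ : ∀ u v → Adj u v ⇔ Edge e (φ.to u) (φ.to v)
  edge⇔ = proj₂ builds

  pullback : Node e → Block Adj t
  pullback N = record
    { In    = In ∘ φ.to
    ; in?   = in? ∘ φ.to
    ; lab   = λ u → inject≤ (lab (φ.to u)) k≤t
    ; twins = λ {u} {u′} {w} u∈ u′∈ eq w∉ uw →
        Equivalence.from (edge⇔ u′ w)
          (twins u∈ u′∈ (inject≤-injective k≤t k≤t _ _ eq) w∉ (Equivalence.to (edge⇔ u w) uw))
    }
    where open Node N

  opaque
    entry : Array n (4 * t + 3) → Slot t → Maybe (Fin n)
    entry a s = lookup a (slot.from s)

    fromEntries : (Slot t → Maybe (Fin n)) → Array n (4 * t + 3)
    fromEntries f = tabulate (f ∘ slot.to)

    entry-fromEntries : ∀ f s → entry (fromEntries f) s ≡ f s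
    entry-fromEntries f s =
      trans (lookup∘tabulate (f ∘ slot.to) (slot.from s)) (cong f (slot.strictlyInverseˡ s))

    fromEntries⁺ : ∀ {P : Pred (Maybe (Fin n)) 0ℓ} {f} → (∀ s → P (f s)) →
                   VecAll.All P (fromEntries f)
    fromEntries⁺ Pf = VecAll.tabulate⁺ (Pf ∘ slot.to)

  -- Decoding arrays into balls

  sides : (p q m : Maybe (Fin n)) → Fin 2 → Side G t
  -- Empty slots serve as the tag: no `p` means no centre, and no `q` means that the centre is `p`.
  -- Otherwise side 0 handles sample vertices outside `outer`, and side 1 those inside `lca`.
  sides nothing  _        _ _  = void G
  sides (just p) nothing  _ _  = point G 0<t p
  sides (just p) (just q) m 0F = outward G (pullback (outer e (φ.to p) (Maybe.map φ.to m)))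
  sides (just p) (just q) _ 1F = inward G (pullback (lca e (φ.to p) (φ.to q)))

  sidesOf : Array n (4 * t + 3) → Fin 2 → Side G t
  sidesOf a = sides (entry a (inj₂ 0F)) (entry a (inj₂ 1F)) (entry a (inj₂ 2F))

  sides-cong : ∀ {p p′ q q′ m m′} → p ≡ p′ → q ≡ q′ → m ≡ m′ → sides p q m ≡ sides p′ q′ m′
  sides-cong refl refl refl = refl

  -- Stored positives must be reached through their own direction `i`, not merely reached: vertices
  -- before them inherit membership along `i` only.
  record Fits (S : Fin 2 → Side G t) (f : Slot t → Maybe (Fin n)) (r : ℕ) (c : Fin n) : Set where
    open Side
    field
      center   : ∀ s → Center (S s) c
      positive : ∀ s i → MaybeAll.All (Through (S s) i r c) (f (inj₁ ((s , 0F) , i)))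
      negative : ∀ s i → MaybeAll.All (λ v → ¬ Through (S s) i r c v) (f (inj₁ ((s , 1F) , i)))

  open Fits

  fits-cong : ∀ {S f g r c} → (∀ s → f s ≡ g s) → Fits S f r c → Fits S g r c
  fits-cong f≗g fits = record
    { center   = center fits
    ; positive = λ s i → subst (MaybeAll.All _) (f≗g _) (positive fits s i)
    ; negative = λ s i → subst (MaybeAll.All _) (f≗g _) (negative fits s i)
    }

  fits? : ∀ S f r c → Dec (Fits S f r c)
  fits? S f r c =
    map′ (λ (x , y , z) → record { center = x ; positive = y ; negative = z })
         (λ fits → center fits , positive fits , negative fits)
         (all? (λ s → center? (S s) c)
            ×-dec all? (λ s → all? λ i → MaybeAll.dec (through? (S s) i r c) _)
            ×-dec all? (λ s → all? λ i → MaybeAll.dec (¬? ∘ through? (S s) i r c) _))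
    where open Side

  Fitting : (Fin 2 → Side G t) → (Slot t → Maybe (Fin n)) → Set
  Fitting S f = ∃[ r ] r < suc n × ∃[ c ] Fits S f r c

  opaque
    fitting? : ∀ S f → Dec (Fitting S f)
    fitting? S f = anyUpTo? (λ r → any? (fits? S f r)) (suc n)

  -- Any fitting ball will do; it may differ from the ball that witnessed the sample.
  ballOf : ∀ {S f} → Dec (Fitting S f) → Subset n
  ballOf (yes (r , _ , c , _)) = ball G r c
  ballOf (no _)                = ∅

  ρ : Array n (4 * t + 3) → Subset n
  ρ a = ballOf (fitting? (sidesOf a) (entry a))

  -- Provides a centre for the empty ball.
  someVertex : ∀ {k} (e : Expr k) → Vertex e
  someVertex (vertex _)      = tt
  someVertex (a ⊕ _)         = inj₁ (someVertex a)
  someVertex (join _ _ _ a)  = someVertex a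
  someVertex (relabel _ _ a) = someVertex a

  ballOf-proper : ∀ {S f} (d : Dec (Fitting S f)) → ballHypergraph G (ballOf d)
  ballOf-proper (yes (r , _ , c , _)) = c , + r , ball-isBall G r c
  ballOf-proper (no _)                =
    let c = φ.from (someVertex e) in c , -[1+ 0 ] , ∅-isBall G c

  ρ-proper : ∀ a → ballHypergraph G (ρ a)
  ρ-proper a = ballOf-proper (fitting? (sidesOf a) (entry a))

  Within : Subset n → Subset n → Pred (Array n (4 * t + 3)) 0ℓ
  Within X⁺ X⁻ = VecAll.All (MaybeAll.All (_∈ X⁺ ∪ X⁻))

  Compresses : Subset n → Subset n → Pred (Array n (4 * t + 3)) 0ℓ
  Compresses X⁺ X⁻ a = Within X⁺ X⁻ a × Realizes (ρ a) X⁺ X⁻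

  compresses? : ∀ X⁺ X⁻ → Decidable (Compresses X⁺ X⁻)
  compresses? X⁺ X⁻ a =
    VecAll.all? (MaybeAll.dec (_∈? X⁺ ∪ X⁻)) a ×-dec X⁺ ⊆? ρ a ×-dec ¬? (nonempty? (ρ a ∩ X⁻))

  -- Encoding samples as arrays

  module _ (X⁺ X⁻ : Subset n) where

    X : Pred (Fin n) 0ℓ
    X v = v ∈ X⁺ ∪ X⁻

    record Sides (c : Fin n) : Set where
      field
        p q m   : Maybe (Fin n)
        p∈      : MaybeAll.All X p
        q∈      : MaybeAll.All X q
        m∈      : MaybeAll.All X m
        centers : ∀ s → Side.Center (sides p q m s) c
        cover   : ∀ v → X v → ∃[ s ] Side.Scope (sides p q m s) v

    -- A centre in the sample gives `point` on both sides; any other centre is separated from the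
    -- sample in `e`, and the result is carried back along the isomorphism.
    findSides : ∃ X → ∀ c → Sides c
    findSides (v , v∈) c with c ∈? X⁺ ∪ X⁻
    ... | yes c∈ = record
      { p = just c ; q = nothing ; m = nothing ; p∈ = just c∈ ; q∈ = nothing ; m∈ = nothing
      ; centers = λ _ → refl ; cover = λ _ _ → 0F , tt }
    ... | no c∉ = pull (separate e Y? (φ.to v , v , refl , v∈) Y∌c)
      where
      -- The explicit preimage lets `build` match on `refl` and read the separating vertices as
      -- sample vertices of `G`.
      Y : Pred (Vertex e) 0ℓ
      Y y = ∃[ u ] φ.to u ≡ y × X u

      Y? : Decidable Y
      Y? y = map′ (λ x → φ.from y , φ.strictlyInverseˡ y , x)
                  (λ { (u , refl , x) → subst X (sym (φ.strictlyInverseʳ u)) x })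
                  (φ.from y ∈? X⁺ ∪ X⁻)

      Y∌c : ¬ Y (φ.to c)
      Y∌c (u , eq , x) = c∉ (subst X (Injection.injective (↔⇒↣ (proj₁ builds)) eq) x)

      pull : Separation e Y (φ.to c) → Sides c
      pull S = build (Separation.p∈ S) (Separation.q∈ S) (preimage (Separation.m∈ S))
                     (Separation.c∉ S) (Separation.c∈ S) (Separation.cover S)
        where
        preimage : ∀ {m} → MaybeAll.All Y m → ∃[ m′ ] Maybe.map φ.to m′ ≡ m × MaybeAll.All X m′
        preimage nothing               = nothing , refl , nothing
        preimage (just (u , refl , x)) = just u , refl , just x

        build : ∀ {p q m} → Y p → Y q → ∃[ m′ ] Maybe.map φ.to m′ ≡ m × MaybeAll.All X m′ →
                ¬ Node.In (lca e p q) (φ.to c) → Node.In (outer e p m) (φ.to c) →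
                (∀ y → Y y → Node.In (lca e p q) y ⊎ ¬ Node.In (outer e p m) y) → Sides c
        build (p , refl , p∈) (q , refl , q∈) (m , refl , m∈) c∉ c∈ cover = record
          { p = just p ; q = just q ; m = m ; p∈ = just p∈ ; q∈ = just q∈ ; m∈ = m∈
          ; centers = λ { 0F → c∈ ; 1F → c∉ }
          ; cover = λ u x → case cover (φ.to u) (u , refl , x) of λ where
              (inj₁ u∈) → 1F , u∈
              (inj₂ u∉) → 0F , u∉ }

    module _ (S : Side G t) (r : ℕ) (c : Fin n) (i : Fin t) where
      open Side S

      -- Any ball of radius at most `n` that contains this vertex through `i` contains through `i`
      -- all positives counted here.
      farthestPositive : ∃[ m ] MaybeAll.All (λ v → v ∈ X⁺ × Through i r c v) m ×
                           (∀ v → v ∈ X⁺ × Through i r c v → Any (Before i v) m)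
      farthestPositive =
        greatest {_≼_ = Before i} before-trans before-total
                 (λ v → v ∈? X⁺ ×-dec through? i r c v)

      -- The order is reversed: a ball of radius at most `n` that misses this vertex through `i`
      -- misses all vertices counted here through `i`.
      nearestNegative : ∃[ m ] MaybeAll.All (λ v → v ∈ X⁻ × ¬ Through i r c v) m ×
                          (∀ v → v ∈ X⁻ × ¬ Through i r c v → Any (λ u → Before i u v) m)
      nearestNegative =
        greatest {_≼_ = λ u v → Before i v u} (λ v≼u w≼v → before-trans w≼v v≼u)
                 (λ u v → before-total v u)
                 (λ v → v ∈? X⁻ ×-dec ¬? (through? i r c v))

    module _ {r : ℕ} {c : Fin n} (S : Sides c)
             (X⁺-reach : ∀ v → v ∈ X⁺ → Reach G r c v)
             (X⁻-reach : ∀ v → v ∈ X⁻ → ¬ Reach G r c v) where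
      open Sides S
      open Side using (split; glue; Before; Through; through-before)

      entries : Slot t → Maybe (Fin n)
      entries (inj₁ ((s , 0F) , i)) = proj₁ (farthestPositive (sides p q m s) r c i)
      entries (inj₁ ((s , 1F) , i)) = proj₁ (nearestNegative (sides p q m s) r c i)
      entries (inj₂ 0F)             = p
      entries (inj₂ 1F)             = q
      entries (inj₂ 2F)             = m

      entries-within : ∀ s → MaybeAll.All X (entries s)
      entries-within (inj₁ ((s , 0F) , i)) =
        MaybeAll.map (λ (v∈ , _) → x∈p∪q⁺ (inj₁ v∈))
                     (proj₁ (proj₂ (farthestPositive (sides p q m s) r c i)))
      entries-within (inj₁ ((s , 1F) , i)) =
        MaybeAll.map (λ (v∈ , _) → x∈p∪q⁺ (inj₂ v∈))
                     (proj₁ (proj₂ (nearestNegative (sides p q m s) r c i)))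
      entries-within (inj₂ 0F) = p∈
      entries-within (inj₂ 1F) = q∈
      entries-within (inj₂ 2F) = m∈

      entries-fit : Fits (sides p q m) entries r c
      entries-fit = record
        { center   = centers
        ; positive = λ s i →
            MaybeAll.map proj₂ (proj₁ (proj₂ (farthestPositive (sides p q m s) r c i)))
        ; negative = λ s i →
            MaybeAll.map proj₂ (proj₁ (proj₂ (nearestNegative (sides p q m s) r c i)))
        }

      module _ {r′ : ℕ} {c′ : Fin n} (r′≤n : r′ ≤ n)
               (fits : Fits (sides p q m) entries r′ c′) where

        -- `split` at the true centre `c` yields a direction for `v`; the stored farthest positive
        -- passes it on to `c′`, where `glue` applies.
        fits-positive : ∀ v → v ∈ X⁺ → Reach G r′ c′ v
        fits-positive v v∈ =
          let s , v∈s  = cover v (x∈p∪q⁺ (inj₁ v∈))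
              i , thru = split (sides p q m s) (centers s) v∈s (X⁺-reach v v∈)
              _ , _ , top = farthestPositive (sides p q m s) r c i
          in glue (sides p q m s) (center fits s) v∈s
                  (transfer s i (top v (v∈ , thru)) (positive fits s i))
          where
          transfer : ∀ s i {u} → Any (Before (sides p q m s) i v) u →
                     MaybeAll.All (Through (sides p q m s) i r′ c′) u →
                     Through (sides p q m s) i r′ c′ v
          transfer s i (just v≼u) (just thru) = through-before (sides p q m s) r′≤n v≼u thru

        -- Dually, `split` is applied at the candidate `c′` and `glue` at the true centre `c`: a
        -- direction admitting `v` from `c′` would admit the stored nearest negative.
        fits-negative : ∀ v → v ∈ X⁻ → ¬ Reach G r′ c′ v
        fits-negative v v∈ reach =
          let s , v∈s   = cover v (x∈p∪q⁺ (inj₂ v∈))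
              i , thru′ = split (sides p q m s) (center fits s) v∈s reach
              _ , _ , top = nearestNegative (sides p q m s) r c i
              ¬thru = λ thru → X⁻-reach v v∈ (glue (sides p q m s) (centers s) v∈s thru)
          in refute s i (top v (v∈ , ¬thru)) (negative fits s i) thru′
          where
          refute : ∀ s i {u} → Any (λ u → Before (sides p q m s) i u v) u →
                   MaybeAll.All (λ u → ¬ Through (sides p q m s) i r′ c′ u) u →
                   ¬ Through (sides p q m s) i r′ c′ v
          refute s i (just u≼v) (just ¬thru) thru =
            ¬thru (through-before (sides p q m s) r′≤n u≼v thru)

      code : Array n (4 * t + 3)
      code = fromEntries entries

      code-sides : sidesOf code ≡ sides p q m
      code-sides = sides-cong (entry-fromEntries entries (inj₂ 0F))
                              (entry-fromEntries entries (inj₂ 1F))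
                              (entry-fromEntries entries (inj₂ 2F))

      code-fits : ∀ {r c} → Fits (sides p q m) entries r c → Fits (sidesOf code) (entry code) r c
      code-fits fits = subst (λ T → Fits T (entry code) _ _) (sym code-sides)
        (fits-cong (λ s → sym (entry-fromEntries entries s)) fits)

      fits-code : ∀ {r c} → Fits (sidesOf code) (entry code) r c → Fits (sides p q m) entries r c
      fits-code fits = fits-cong (entry-fromEntries entries)
        (subst (λ T → Fits T (entry code) _ _) code-sides fits)

      ballOf-realizes : r ≤ n → (d : Dec (Fitting (sidesOf code) (entry code))) →
                        Realizes (ballOf d) X⁺ X⁻
      ballOf-realizes r≤n (no ∄) = contradiction (r , s≤s r≤n , c , code-fits entries-fit) ∄
      ballOf-realizes r≤n (yes (r′ , r′≤n , c′ , fits)) =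
        (λ v∈ → Equivalence.from (∈-comprehension (reach? G r′ c′))
                  (fits-positive (s≤s⁻¹ r′≤n) (fits-code fits) _ v∈)) ,
        λ (v , v∈) → let v∈ball , v∈X⁻ = x∈p∩q⁻ (ball G r′ c′) X⁻ v∈ in
          fits-negative (s≤s⁻¹ r′≤n) (fits-code fits) v v∈X⁻
            (Equivalence.to (∈-comprehension (reach? G r′ c′)) v∈ball)

      code-compresses : r ≤ n → Compresses X⁺ X⁻ code
      code-compresses r≤n = fromEntries⁺ entries-within ,
                            ballOf-realizes r≤n (fitting? (sidesOf code) (entry code))

  emptyCode : Array n (4 * t + 3)
  emptyCode = fromEntries (λ _ → nothing)

  -- With the first slot empty both sides are `void`, so the search finds no centre.
  ballOf-void : ∀ {p q m f} → p ≡ nothing → (d : Dec (Fitting (sides p q m) f)) → ballOf d ≡ ∅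
  ballOf-void _    (no _)                   = refl
  ballOf-void refl (yes (_ , _ , _ , fits)) = ⊥-elim (center fits 0F)

  ρ-emptyCode : ρ emptyCode ≡ ∅
  ρ-emptyCode = ballOf-void (entry-fromEntries (λ _ → nothing) (inj₂ 0F))
                            (fitting? (sidesOf emptyCode) (entry emptyCode))

  compressible : ∀ X⁺ X⁻ → IsSample (ballHypergraph G) X⁺ X⁻ → ∃ (Compresses X⁺ X⁻)
  compressible X⁺ X⁻ (B , (c , _ , isBall) , X⁺⊆B , X⁻∩B) with nonempty? X⁺
  -- The witnessing ball may be empty here, beyond the reach of `isBall-bounded`; decoding to `∅`
  -- realizes every such sample.
  ... | no X⁺-empty =
    emptyCode , fromEntries⁺ (λ _ → nothing) ,
    (λ {v} v∈ → contradiction (v , v∈) X⁺-empty) ,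
    λ (v , v∈) → ∉⊥ (subst (v ∈_) ρ-emptyCode (proj₁ (x∈p∩q⁻ (ρ emptyCode) X⁻ v∈)))
  ... | yes (v , v∈) =
    let r , r≤n , ball⇔ = isBall-bounded G isBall (X⁺⊆B v∈)
        S = findSides X⁺ X⁻ (v , x∈p∪q⁺ (inj₁ v∈)) c
        X⁺-reach = λ u u∈ → Equivalence.to (ball⇔ u) (X⁺⊆B u∈)
        X⁻-reach = λ u u∈ reach → X⁻∩B (u , x∈p∩q⁺ (u∈ , Equivalence.from (ball⇔ u) reach))
    in code X⁺ X⁻ S X⁺-reach X⁻-reach , code-compresses X⁺ X⁻ S X⁺-reach X⁻-reach r≤n

  opaque
    -- `compressible` inspects the witnessing ball, which `κ` may not. It only shows that a search
    -- succeeds, and the array comes from that search.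
    compress : ∀ X⁺ X⁻ → .(IsSample (ballHypergraph G) X⁺ X⁻) → ∃ (Compresses X⁺ X⁻)
    compress X⁺ X⁻ s = recompute (anyArray? (compresses? X⁺ X⁻)) (compressible X⁺ X⁻ s)

  scheme : ArraySampleCompressionScheme (ballHypergraph G) (4 * t + 3)
  scheme = record
    { κ        = λ X⁺ X⁻ s → proj₁ (compress X⁺ X⁻ s)
    ; ρ        = ρ
    ; κ-within = λ X⁺ X⁻ s → proj₁ (proj₂ (compress X⁺ X⁻ s))
    ; realizes = λ X⁺ X⁻ s → proj₂ (proj₂ (compress X⁺ X⁻ s))
    }

theorem2p2 : ∀ (t : ℕ) → 0 < t → ∀ (n : ℕ) (G : Graph n) → CliquewidthAtMost G t →
    HasProperArraySampleCompressionScheme (ballHypergraph G) (4 * t + 3)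
theorem2p2 t 0<t n G (k , ((e , builds) , _) , k≤t) = scheme , ρ-proper
  where open Scheme G 0<t k≤t e builds
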